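{- Let $\mathcal{G}=(V,E,\lambda)$ be a happy compressed temporal graph that is temporally connected and minimal. Then the number of divergent edges of $\mathcal{G}$ is at most the number of edges $e\in E$ with $\lambda(e)=1$.
   Context: A happy temporal graph is a triple $\mathcal{G}=(V,E,\lambda)$ where $(V,E)$ is a finite simple undirected graph (the footprint) and $\lambda:E\to\{1,2,3,\dots\}$ assigns a single time label to each edge, such that two distinct edges sharing an endpoint have different labels. It is compressed if for every edge $e$ with $\lambda(e)>1$ there is an edge $e'$ adjacent to $e$ with $\lambda(e')=\lambda(e)-1$. A temporal walk is a walk in the footprint along which edge labels are strictly increasing (so no edge is repeated). For vertices $u,v$ and edges $e,e'$: $u\leadsto v$ means there is a temporal walk from $u$ to $v$; $e\leadsto v$ means some temporal walk traverses $e$ and ends at $v$; $e\leadsto e'$ means some temporal walk traverses $e$ and $e'$ in this order, not necessarily consecutively (with $e\leadsto e$ always). Edges may be traversed in either direction. $\mathcal{G}$ is temporally connected if $u\leadsto v$ for all distinct $u,v\in V$. The reachability graph $\mathcal{R}(\mathcal{G})$ is the directed graph on $V$ with arcs $(u,v)$ whenever $u\leadsto v$; $\mathcal{G}$ is minimal if $\mathcal{R}(\mathcal{G}\setminus\{e\})\ne\mathcal{R}(\mathcal{G})$ for every $e\in E$ (deleting $e$, keeping all vertices and the other labelled edges). An edge $e$ is a source edge if $e\leadsto v$ for all $v\in V$. A divergent edge is a source edge $e$ such that there is no other source edge $e'\neq e$ with $e\leadsto e'$. -}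

module Defs where

open import Data.Fin using (Fin; zero; suc; punchIn)
open import Data.Fin.Properties using (_≟_; any?; all?; punchIn-injective; injective⇒≤)
open import Data.List using (List; []; _∷_; length; lookup; filter; allFin)
open import Data.List.Membership.DecPropositional using (_∈?_)
open import Data.List.Membership.Propositional using (_∈_)
open import Data.List.Membership.Propositional.Properties using (∈-lookup)
open import Data.List.Relation.Binary.Sublist.DecPropositional using (_⊆?_)
open import Data.List.Relation.Binary.Sublist.Propositional using (_⊆_)
open import Data.List.Relation.Unary.All as All using ()
open import Data.List.Relation.Unary.AllPairs as AllPairs using (AllPairs; []; _∷_)
open import Data.List.Relation.Unary.Linked using (Linked; linked?)
open import Data.List.Relation.Unary.Linked.Properties using (Linked⇒AllPairs)
open import Data.List.Relation.Unary.Unique.Propositional using (Unique)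
open import Data.Nat using (ℕ; zero; suc; pred; _≤_; _<_; z≤n; s≤s)
open import Data.Nat.Properties as ℕ using (<-trans; <-irrefl; _<?_)
open import Data.Product using (∃; ∃-syntax; _×_; _,_)
open import Data.Sum using (_⊎_; inj₁; inj₂)
open import Function using (_∘_)
open import Relation.Binary.Core using (Rel; _⇔_)
open import Relation.Binary.PropositionalEquality using (_≡_; _≢_; refl; sym; cong)
open import Relation.Nullary using (¬_; Dec; yes; no; contradiction)
open import Relation.Nullary.Decidable using (map′; _×-dec_; _⊎-dec_; ¬?)
open import Relation.Unary using (Pred; Decidable)
open import Level using (0ℓ)

-- Edges are indexed by Fin m.  The order of the two endpoints of an edge
-- carries no meaning: they are only used through the symmetric relation Joins.
record Graph (n m : ℕ) : Set where
  field
    end₁ end₂ : Fin m → Fin n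

  Joins : Fin m → Fin n → Fin n → Set
  Joins e u v = (end₁ e ≡ u × end₂ e ≡ v) ⊎ (end₁ e ≡ v × end₂ e ≡ u)

  Incident : Fin m → Fin n → Set
  Incident e v = end₁ e ≡ v ⊎ end₂ e ≡ v

  Adjacent : Rel (Fin m) 0ℓ
  Adjacent e f = e ≢ f × ∃[ v ] (Incident e v × Incident f v)

  field
    loopless : ∀ e → end₁ e ≢ end₂ e
    simple   : ∀ {e f u v} → Joins e u v → Joins f u v → e ≡ f

record HappyTemporalGraph (n m : ℕ) : Set where
  field
    footprint : Graph n m
  open Graph footprint public
  field
    label          : Fin m → ℕ
    label-positive : ∀ e → 1 ≤ label e
    label-proper   : ∀ {e f} → Adjacent e f → label e ≢ label f

-- Deletion of an edge: all vertices and all other labelled edges are kept,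
-- the latter re-indexed along punchIn e.
_∖_ : ∀ {n m} → HappyTemporalGraph n m → Fin m → HappyTemporalGraph n (pred m)
_∖_ {m = suc m} G e = record
  { footprint = record
    { end₁     = end₁ ∘ punchIn e
    ; end₂     = end₂ ∘ punchIn e
    ; loopless = loopless ∘ punchIn e
    ; simple   = λ p q → punchIn-injective e _ _ (simple p q)
    }
  ; label          = label ∘ punchIn e
  ; label-positive = label-positive ∘ punchIn e
  ; label-proper   = λ (f≢g , adj) →
                       label-proper (f≢g ∘ punchIn-injective e _ _ , adj)
  }
  where open HappyTemporalGraph G

module _ {n m : ℕ} (G : HappyTemporalGraph n m) where
  open HappyTemporalGraph G

  data Walk : Fin n → Fin n → Set where
    []  : ∀ {v} → Walk v v
    _∷_ : ∀ {e u v w} → Joins e u v → Walk v w → Walk u w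

  edges : ∀ {u v} → Walk u v → List (Fin m)
  edges []              = []
  edges (_∷_ {e = e} _ w) = e ∷ edges w

  Increasing : List (Fin m) → Set
  Increasing = Linked (λ e f → label e < label f)

  -- The empty walk is temporal, so every vertex reaches itself.
  Reachable : Rel (Fin n) 0ℓ
  Reachable u v = ∃[ w ] Increasing (edges {u} {v} w)

  EdgeReachesVertex : Fin m → Fin n → Set
  EdgeReachesVertex e v =
    ∃[ u ] ∃[ w ] (Increasing (edges {u} {v} w) × e ∈ edges w)

  -- The sublist relation _⊆_ keeps the order but allows gaps.
  EdgeReachesEdge : Rel (Fin m) 0ℓ
  EdgeReachesEdge e f =
    e ≡ f ⊎
    (∃[ u ] ∃[ v ] ∃[ w ] (Increasing (edges {u} {v} w) × (e ∷ f ∷ []) ⊆ edges w))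

  Compressed : Set
  Compressed = ∀ e → 1 < label e → ∃[ f ] (Adjacent e f × suc (label f) ≡ label e)

  TemporallyConnected : Set
  TemporallyConnected = ∀ {u v} → u ≢ v → Reachable u v

  SourceEdge : Pred (Fin m) 0ℓ
  SourceEdge e = ∀ v → EdgeReachesVertex e v

  DivergentEdge : Pred (Fin m) 0ℓ
  DivergentEdge e =
    SourceEdge e × ¬ (∃[ f ] (f ≢ e × SourceEdge f × EdgeReachesEdge e f))

-- The reachability graphs of G and G ∖ e share their vertex set, so they
-- differ exactly when their arc relations are not equivalent.
Minimal : ∀ {n m} → HappyTemporalGraph n m → Set
Minimal G = ∀ e → ¬ (Reachable (G ∖ e) ⇔ Reachable G)

-- Divergence is decidable: a walk with increasing labels repeats no edge, so
-- its length is at most m and a bounded search decides each of the relations.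
private
  lookup-inj : ∀ {A : Set} {xs : List A} → Unique xs →
               ∀ i j → lookup xs i ≡ lookup xs j → i ≡ j
  lookup-inj (_ ∷ _)      zero    zero    _  = refl
  lookup-inj (x∉xs ∷ _)   zero    (suc j) eq =
    contradiction eq (All.lookup x∉xs (∈-lookup j))
  lookup-inj (x∉xs ∷ _)   (suc i) zero    eq =
    contradiction (sym eq) (All.lookup x∉xs (∈-lookup i))
  lookup-inj (_ ∷ xs!)    (suc i) (suc j) eq = cong suc (lookup-inj xs! i j eq)

module _ {n m : ℕ} (G : HappyTemporalGraph n m) where
  open HappyTemporalGraph G

  private
    joins? : ∀ e u v → Dec (Joins e u v)
    joins? e u v = ((end₁ e ≟ u) ×-dec (end₂ e ≟ v))
                   ⊎-dec ((end₁ e ≟ v) ×-dec (end₂ e ≟ u))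

    increasing? : Decidable (Increasing G)
    increasing? = linked? (λ e f → label e <? label f)

    length≤m : ∀ {es} → Increasing G es → length es ≤ m
    length≤m inc = injective⇒≤ (lookup-inj (AllPairs.map (λ { lt refl → <-irrefl refl lt })
                     (Linked⇒AllPairs <-trans inc)) _ _)

    boundedWalk? : ∀ k {P : Pred (List (Fin m)) 0ℓ} → Decidable P → ∀ u v →
                   Dec (∃[ w ] (length (edges G {u} {v} w) ≤ k × P (edges G w)))
    boundedWalk? zero P? u v with u ≟ v | P? []
    ... | no u≢v   | _      = no λ { ([] , _) → u≢v refl ; ((_ ∷ _) , () , _) }
    ... | yes refl | yes p  = yes ([] , z≤n , p)
    ... | yes refl | no ¬p  = no λ { ([] , _ , p) → ¬p p ; ((_ ∷ _) , () , _) }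
    boundedWalk? (suc k) {P} P? u v =
      map′ to from
        (((u ≟ v) ×-dec P? [])
         ⊎-dec any? λ e → any? λ x →
                 joins? e u x ×-dec boundedWalk? k (P? ∘ (e ∷_)) x v)
      where
      to : _ → ∃[ w ] (length (edges G {u} {v} w) ≤ suc k × P (edges G w))
      to (inj₁ (refl , p))                 = [] , z≤n , p
      to (inj₂ (_ , _ , j , w , len , p)) = j ∷ w , s≤s len , p
      from : ∃[ w ] (length (edges G {u} {v} w) ≤ suc k × P (edges G w)) → _
      from ([] , _ , p)          = inj₁ (refl , p)
      from (j ∷ w , s≤s len , p) = inj₂ (_ , _ , j , w , len , p)

    temporalWalk? : {P : Pred (List (Fin m)) 0ℓ} → Decidable P → ∀ u v →
                    Dec (∃[ w ] (Increasing G (edges G {u} {v} w) × P (edges G w)))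
    temporalWalk? P? u v =
      map′ (λ (w , _ , p) → w , p) (λ (w , inc , p) → w , length≤m inc , inc , p)
           (boundedWalk? m (λ es → increasing? es ×-dec P? es) u v)

  edgeReachesVertex? : ∀ e v → Dec (EdgeReachesVertex G e v)
  edgeReachesVertex? e v = any? λ u → temporalWalk? (_∈?_ _≟_ e) u v

  edgeReachesEdge? : ∀ e f → Dec (EdgeReachesEdge G e f)
  edgeReachesEdge? e f =
    (e ≟ f) ⊎-dec (any? λ u → any? λ v → temporalWalk? (_⊆?_ _≟_ (e ∷ f ∷ [])) u v)

  sourceEdge? : Decidable (SourceEdge G)
  sourceEdge? e = all? (edgeReachesVertex? e)

  divergentEdge? : Decidable (DivergentEdge G)
  divergentEdge? e =
    sourceEdge? e ×-dec
    ¬? (any? λ f → ¬? (f ≟ e) ×-dec (sourceEdge? f ×-dec edgeReachesEdge? e f))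

  labelledOne? : Decidable (λ e → label e ≡ 1)
  labelledOne? e = label e ℕ.≟ 1

count : ∀ {m} {P : Pred (Fin m) 0ℓ} → Decidable P → ℕ
count {m} P? = length (filter P? (allFin m))

{-# OPTIONS --safe #-}

-- If both ends of an edge f reach every vertex using only labels above that of
-- f, then f is redundant: a temporal walk about to cross f can instead follow
-- such a walk, and its earlier part has labels below that of f.  In a minimal
-- graph it follows that each edge leads to at most one divergent edge.  Indeed,
-- suppose f leads to two of them.  If the two walks leave f at opposite ends,
-- then f is redundant.  Otherwise let z be the vertex where they first part: of
-- the two edges taken at z, the one with the smaller label is redundant, or it
-- is itself divergent and leads to the other divergent edge, contrary to
-- divergence.  By compression every edge is led to by an edge labelled 1, and
-- sending divergent edges to such edges is injective.
module Submission where

open import Defs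
open import Data.Fin using (Fin; zero; suc; punchIn; punchOut)
open import Data.Fin.Properties using (_≟_; injective⇒≤; punchIn-punchOut)
open import Data.List using (List; _∷_; length; lookup; filter; allFin)
open import Data.List.Membership.Propositional using (_∈_)
open import Data.List.Membership.Propositional.Properties
  using (∈-lookup; ∈-filter⁺; ∈-filter⁻; ∈-allFin)
open import Data.List.Relation.Binary.Sublist.Propositional using (from∈)
import Data.List.Relation.Binary.Sublist.Propositional as Sublist
open import Data.List.Relation.Unary.All as All using ()
open import Data.List.Relation.Unary.AllPairs using (_∷_)
open import Data.List.Relation.Unary.Any using (here; there; index)
open import Data.List.Relation.Unary.Any.Properties using (lookup-index)
open import Data.List.Relation.Unary.Linked as Linked using ([]; [-]; _∷_)
open import Data.List.Relation.Unary.Unique.Propositional using (Unique)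
open import Data.List.Relation.Unary.Unique.Propositional.Properties using (filter⁺; allFin⁺)
open import Data.Nat using (ℕ; zero; suc; _≤_; _<_; z≤n; s≤s)
open import Data.Nat.Properties
  using (≤-refl; ≤-reflexive; ≤-trans; n≤1+n; <-trans; <-cmp; <-irrefl; suc-injective)
open import Data.Product using (∃-syntax; _×_; _,_; proj₁; proj₂)
open import Data.Sum using (_⊎_; inj₁; inj₂; swap)
open import Function using (_∘_)
open import Level using (0ℓ)
open import Relation.Binary.Definitions using (tri<; tri≈; tri>)
open import Relation.Binary.PropositionalEquality
  using (_≡_; _≢_; refl; sym; trans; cong; subst)
open import Relation.Nullary using (¬_; yes; no; contradiction)
open import Relation.Unary using (Pred; Decidable)

-- Counting by injections.

lookup-injective : ∀ {A : Set} {xs : List A} → Unique xs →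
                   ∀ {i j} → lookup xs i ≡ lookup xs j → i ≡ j
lookup-injective (_ ∷ _)    {zero}  {zero}  _  = refl
lookup-injective (x∉xs ∷ _) {zero}  {suc j} eq =
  contradiction eq (All.lookup x∉xs (∈-lookup j))
lookup-injective (x∉xs ∷ _) {suc i} {zero}  eq =
  contradiction (sym eq) (All.lookup x∉xs (∈-lookup i))
lookup-injective (_ ∷ xs!)  {suc i} {suc j} eq = cong suc (lookup-injective xs! eq)

-- Whatever witness `image` picks for `e`, it determines `e` through `R`, so positions in the
-- filtered list for `P` inject into positions in the one for `Q`.
count-≤ : ∀ {m} {P Q : Pred (Fin m) 0ℓ} (P? : Decidable P) (Q? : Decidable Q)
          {R : Fin m → Fin m → Set} →
          (∀ e → P e → ∃[ f ] (Q f × R f e)) →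
          (∀ {f e e′} → P e → P e′ → R f e → R f e′ → e ≡ e′) →
          count P? ≤ count Q?
count-≤ {m} {P} P? Q? {R} image functional =
  injective⇒≤ {f = φ} λ {i} {j} eq →
    lookup-injective (filter⁺ P? (allFin⁺ m))
      (functional (holds i) (holds j) (related i)
        (subst (λ k → R k (lookup ps j)) (target-injective eq) (related j)))
  where
  ps qs : List (Fin m)
  ps = filter P? (allFin m)
  qs = filter Q? (allFin m)

  holds : ∀ i → P (lookup ps i)
  holds i = proj₂ (∈-filter⁻ P? {xs = allFin m} (∈-lookup i))

  target : ∀ i → Fin m
  target i = proj₁ (image _ (holds i))

  target∈ : ∀ i → target i ∈ qs
  target∈ i = ∈-filter⁺ Q? (∈-allFin (target i)) (proj₁ (proj₂ (image _ (holds i))))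

  related : ∀ i → R (target i) (lookup ps i)
  related i = proj₂ (proj₂ (image _ (holds i)))

  φ : Fin (length ps) → Fin (length qs)
  φ i = index (target∈ i)

  target-injective : ∀ {i j} → φ i ≡ φ j → target j ≡ target i
  target-injective {i} {j} eq =
    trans (lookup-index (target∈ j))
          (trans (cong (lookup qs) (sym eq)) (sym (lookup-index (target∈ i))))

-- Temporal walks with bounded labels.

module _ {n m : ℕ} (G : HappyTemporalGraph n m) where
  open HappyTemporalGraph G

  -- k bounds the first label from below, hence all labels of the temporal walk.
  data From (k : ℕ) : Fin n → Fin n → Set where
    []   : ∀ {v} → From k v v
    step : ∀ {e u v w} → Joins e u v → k ≤ label e → From (suc (label e)) v w → From k u w

  -- These are temporal walks that end by crossing `e`, with `inj₁` marking that crossing. The final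
  -- vertex is left out, since only `e` matters.
  data To (e : Fin m) (k : ℕ) : Fin n → Set where
    step : ∀ {g u v} → Joins g u v → k ≤ label g →
           g ≡ e ⊎ To e (suc (label g)) v → To e k u

  Universal : ℕ → Fin n → Set
  Universal k u = ∀ v → From k u v

  -- Unlike `EdgeReachesEdge`, this fixes the direction in which the walk crosses its first edge
  -- `f`, so that two such walks can be compared by the end at which they leave `f`.
  Leads : Fin m → Fin m → Set
  Leads f e = ∃[ a ] ∃[ b ] (Joins f a b × (f ≡ e ⊎ To e (suc (label f)) b))

module _ {n m : ℕ} {G : HappyTemporalGraph n m} where
  open HappyTemporalGraph G

  walk : ∀ {k u v} → From G k u v → Walk G u v
  walk []           = []
  walk (step j _ p) = j ∷ walk p

  walk-increasing : ∀ {k u v} (p : From G k u v) → Increasing G (edges G (walk p))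
  walk-increasing []                             = []
  walk-increasing (step _ _ [])                  = [-]
  walk-increasing (step _ _ p@(step _ below _)) = below ∷ walk-increasing p

  reachable : ∀ {k u v} → From G k u v → Reachable G u v
  reachable p = walk p , walk-increasing p

  private
    steps : ∀ {e u v w} (j : Joins e u v) (r : Walk G v w) →
            Increasing G (e ∷ edges G r) → From G (suc (label e)) v w
    steps j []       _           = []
    steps j (j′ ∷ r) (below ∷ l) = step j′ below (steps j′ r l)

  fromReachable : ∀ {u v} → Reachable G u v → From G 0 u v
  fromReachable ([] , _)    = []
  fromReachable (j ∷ r , l) = step j z≤n (steps j r l)

  weaken : ∀ {k l u v} → k ≤ l → From G l u v → From G k u v
  weaken k≤l []             = []
  weaken k≤l (step j l≤e p) = step j (≤-trans k≤l l≤e) p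

  To⇒From : ∀ {e k u} → To G e k u → ∃[ v ] ∃[ p ] (e ∈ edges G (walk {k} {u} {v} p))
  To⇒From (step j k≤e (inj₁ refl)) = _ , step j k≤e [] , here refl
  To⇒From (step j k≤g (inj₂ q))    = let v , p , e∈p = To⇒From q in v , step j k≤g p , there e∈p

  edgeReachesEdge : ∀ {e f u v} → Joins e u v → To G f (suc (label e)) v →
                    EdgeReachesEdge G e f
  edgeReachesEdge j q =
    let _ , p , f∈p = To⇒From q
        full = step j z≤n p
    in inj₂ (_ , _ , walk full , walk-increasing full , refl Sublist.∷ from∈ f∈p)

  after : ∀ {e u v} (r : Walk G u v) → Increasing G (edges G r) → e ∈ edges G r →
          ∃[ a ] ∃[ b ] (Joins e a b × From G (suc (label e)) b v)
  after (j ∷ r) l (here refl)  = _ , _ , j , steps j r l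
  after (j ∷ r) l (there e∈r) = after r (Linked.tail l) e∈r

  joinsEither : ∀ {e u v a b} → Joins e u v → Joins e a b → (u ≡ a × v ≡ b) ⊎ (u ≡ b × v ≡ a)
  joinsEither (inj₁ (p , q)) (inj₁ (p′ , q′)) = inj₁ (trans (sym p) p′ , trans (sym q) q′)
  joinsEither (inj₁ (p , q)) (inj₂ (p′ , q′)) = inj₂ (trans (sym p) p′ , trans (sym q) q′)
  joinsEither (inj₂ (p , q)) (inj₁ (p′ , q′)) = inj₂ (trans (sym q) q′ , trans (sym p) p′)
  joinsEither (inj₂ (p , q)) (inj₂ (p′ , q′)) = inj₁ (trans (sym q) q′ , trans (sym p) p′)

  farEnd-unique : ∀ {e u v w} → Joins e u v → Joins e u w → v ≡ w
  farEnd-unique j j′ with joinsEither j j′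
  ... | inj₁ (_ , v≡w)   = v≡w
  ... | inj₂ (u≡w , v≡u) = trans v≡u u≡w

  incident⇒joins : ∀ {e v} → Incident e v → ∃[ u ] Joins e u v
  incident⇒joins (inj₁ eq) = _ , inj₂ (eq , refl)
  incident⇒joins (inj₂ eq) = _ , inj₁ (refl , eq)

  joins⇒incident : ∀ {e u v} → Joins e u v → Incident e u
  joins⇒incident (inj₁ (eq , _)) = inj₁ eq
  joins⇒incident (inj₂ (_ , eq)) = inj₂ eq

  -- A walk through `e` leaves it at one of its two ends. From `u`, either cross `e` first or skip
  -- it and follow the rest at once.
  source-universal : ∀ {e u v} → SourceEdge G e → Joins e u v → Universal G (label e) u
  source-universal src j t with src t
  ... | _ , r , l , e∈r with after r l e∈r
  ... | _ , _ , j′ , p with joinsEither j j′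
  ... | inj₁ (refl , refl) = step j ≤-refl p
  ... | inj₂ (refl , refl) = weaken (n≤1+n _) p

  To-universal : ∀ {e k u} → SourceEdge G e → To G e k u → Universal G k u
  To-universal src (step j k≤e (inj₁ refl)) t = weaken k≤e (source-universal src j t)
  To-universal src (step j k≤g (inj₂ q))    t = step j k≤g (To-universal src q t)

-- Deleting an edge.

module _ {n m : ℕ} (G : HappyTemporalGraph n (suc m)) (f : Fin (suc m)) where
  open HappyTemporalGraph G

  include : ∀ {k u v} → From (G ∖ f) k u v → From G k u v
  include []             = []
  include (step j k≤e p) = step j k≤e (include p)

  keep : ∀ {e k u v w} → e ≢ f → Joins e u v → k ≤ label e →
         From (G ∖ f) (suc (label e)) v w → From (G ∖ f) k u w
  keep e≢f j k≤e p = aux (punchIn-punchOut (e≢f ∘ sym)) j k≤e p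
    where
    -- With `e` a variable here, matching on the equation turns ends and labels of `e` into those of
    -- `h` in `G ∖ f`.
    aux : ∀ {h e k u v w} → punchIn f h ≡ e → Joins e u v → k ≤ label e →
          From (G ∖ f) (suc (label e)) v w → From (G ∖ f) k u w
    aux refl j k≤e p = step j k≤e p

  avoid : ∀ {k u v} → label f < k → From G k u v → From (G ∖ f) k u v
  avoid f<k []                 = []
  avoid f<k (step {e} j k≤e p) =
    keep (λ { refl → contradiction (≤-trans f<k k≤e) (<-irrefl refl) }) j k≤e
         (avoid (≤-trans (≤-trans f<k k≤e) (n≤1+n _)) p)

  reroute : ∀ {a b} → Joins f a b →
            Universal G (suc (label f)) a → Universal G (suc (label f)) b →
            ∀ {k u v} → From G k u v → From (G ∖ f) k u v
  reroute ab univ-a univ-b [] = []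
  reroute ab univ-a univ-b (step {e} j k≤e p) with e ≟ f
  ... | no e≢f  = keep e≢f j k≤e (reroute ab univ-a univ-b p)
  ... | yes refl with joinsEither {G = G} j ab
  -- The crossing of `f` and all that follows give way to a walk from the end where `f` would be
  -- entered to the same target.
  ...   | inj₁ (refl , refl) = weaken (≤-trans k≤e (n≤1+n _)) (avoid ≤-refl (univ-a _))
  ...   | inj₂ (refl , refl) = weaken (≤-trans k≤e (n≤1+n _)) (avoid ≤-refl (univ-b _))

redundant : ∀ {n m} (G : HappyTemporalGraph n m) → Minimal G →
            ∀ {f a b} → HappyTemporalGraph.Joins G f a b →
            Universal G (suc (HappyTemporalGraph.label G f)) a →
            ¬ Universal G (suc (HappyTemporalGraph.label G f)) b
redundant {m = suc m} G minimal {f} ab univ-a univ-b = minimal f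
  ( (λ r → reachable (include G f (fromReachable r)))
  , (λ r → reachable (reroute G f ab univ-a univ-b (fromReachable r))) )

-- Uniqueness of the divergent edge led to, and descent to label 1.

module _ {n m : ℕ} (G : HappyTemporalGraph n m) where
  open HappyTemporalGraph G

  divergent-unique : ∀ {e f u v} → DivergentEdge G e → SourceEdge G f →
                     Joins e u v → To G f (suc (label e)) v → e ≡ f
  divergent-unique {e} {f} (_ , stuck) src j q with f ≟ e
  ... | yes f≡e = sym f≡e
  ... | no f≢e  = contradiction (f , f≢e , src , edgeReachesEdge j q) stuck

  module _ (minimal : Minimal G) where

    -- If `g` is `e`, crossing it from `v` to `u` leads on to `e′`, against divergence. Otherwise
    -- walks above the label of `g` reach source edges from both its ends, so `g` is redundant.
    divergent-branch : ∀ {e e′ g u v} → DivergentEdge G e → DivergentEdge G e′ →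
                       Joins g u v → g ≡ e ⊎ To G e (suc (label g)) v →
                       To G e′ (suc (label g)) u → e ≡ e′
    divergent-branch dv dv′ j (inj₁ refl) q′ = divergent-unique dv (proj₁ dv′) (swap j) q′
    divergent-branch dv dv′ j (inj₂ q)    q′ =
      contradiction (To-universal (proj₁ dv) q)
                    (redundant G minimal j (To-universal (proj₁ dv′) q′))

    divergent-To-unique : ∀ {e e′ k k′ u} → DivergentEdge G e → DivergentEdge G e′ →
                          To G e k u → To G e′ k′ u → e ≡ e′
    divergent-To-unique dv dv′ (step {g} j _ t) (step {g′} j′ _ t′) with g ≟ g′
    divergent-To-unique dv dv′ (step j _ t) (step j′ _ t′) | yes refl
      with farEnd-unique {G = G} j j′ | t | t′
    ... | refl | inj₁ refl | inj₁ refl = refl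
    -- One walk ends here while the other goes on, so the first divergent edge leads to the second.
    ... | refl | inj₁ refl | inj₂ q′   = divergent-unique dv (proj₁ dv′) j q′
    ... | refl | inj₂ q    | inj₁ refl = sym (divergent-unique dv′ (proj₁ dv) j q)
    ... | refl | inj₂ q    | inj₂ q′   = divergent-To-unique dv dv′ q q′
    divergent-To-unique dv dv′ (step {g} j _ t) (step {g′} j′ _ t′) | no g≢g′
      with <-cmp (label g) (label g′)
    -- The whole second walk starts at the near end of `g` with labels above that of `g`.
    ... | tri< g<g′ _ _ = divergent-branch dv dv′ j t (step j′ g<g′ t′)
    ... | tri> _ _ g′<g = sym (divergent-branch dv′ dv j′ t′ (step j g′<g t))
    ... | tri≈ _ same _ = contradiction same
      (label-proper (g≢g′ , _ , joins⇒incident {G = G} j , joins⇒incident {G = G} j′))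

    divergent-Leads-unique : ∀ {e e′ f} → DivergentEdge G e → DivergentEdge G e′ →
                             Leads G f e → Leads G f e′ → e ≡ e′
    divergent-Leads-unique dv dv′ (_ , _ , j , t) (_ , _ , j′ , t′) with joinsEither {G = G} j j′
    divergent-Leads-unique dv dv′ (_ , _ , j , t) (_ , _ , j′ , t′) | inj₁ (refl , refl) =
      -- Prepending `f` itself gives both walks a common starting vertex.
      divergent-To-unique dv dv′ (step j ≤-refl t) (step j′ ≤-refl t′)
    -- The walks leave `f` at opposite ends, so `f` plays the part of `g`.
    divergent-Leads-unique dv dv′ (_ , _ , j , t) (_ , _ , j′ , inj₂ q′) | inj₂ (refl , refl) =
      divergent-branch dv dv′ j t q′
    divergent-Leads-unique dv dv′ (_ , _ , j , inj₂ q) (_ , _ , j′ , inj₁ refl) | inj₂ _ =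
      sym (divergent-unique dv′ (proj₁ dv) j q)
    divergent-Leads-unique dv dv′ (_ , _ , j , inj₁ refl) (_ , _ , j′ , inj₁ refl) | inj₂ _ = refl

  -- If g meets f at the end where the walk enters f, then g is prepended;
  -- if at the other end, then g replaces f, unless f is the whole walk, which
  -- may then be reversed.
  Leads-extend : ∀ {e f g} → Adjacent f g → label g < label f → Leads G f e → Leads G g e
  Leads-extend (_ , x , f∋x , g∋x) g<f (a , b , j , t)
    with incident⇒joins {G = G} f∋x | incident⇒joins {G = G} g∋x
  ... | y , yx | c , cx with joinsEither {G = G} j yx | t
  ... | inj₂ (refl , refl) | t         = c , _ , cx , inj₂ (step j g<f t)
  ... | inj₁ (refl , refl) | inj₁ refl = c , _ , cx , inj₂ (step (swap j) g<f (inj₁ refl))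
  ... | inj₁ (refl , refl) | inj₂ (step j′ f<h t′) =
    c , _ , cx , inj₂ (step j′ (<-trans g<f f<h) t′)

  -- Starting from `e` leading to itself, compression supplies an adjacent edge whose label is one
  -- lower, to which the lead is extended backwards until the label is 1.
  ledToByOne : Compressed G → ∀ e → ∃[ f ] (label f ≡ 1 × Leads G f e)
  ledToByOne compressed e = descend _ e refl (_ , _ , inj₁ (refl , refl) , inj₁ refl)
    where
    descend : ∀ k f → label f ≡ k → Leads G f e → ∃[ g ] (label g ≡ 1 × Leads G g e)
    descend zero          f eq _  = contradiction (subst (1 ≤_) eq (label-positive f)) λ ()
    descend (suc zero)    f eq fe = f , eq , fe
    descend (suc (suc k)) f eq fe =
      let g , adj , sg≡f = compressed f (subst (1 <_) (sym eq) (s≤s (s≤s z≤n)))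
      in descend (suc k) g (suc-injective (trans sg≡f eq))
                 (Leads-extend adj (≤-reflexive sg≡f) fe)

lemma3p33 : ∀ {n m : ℕ} (G : HappyTemporalGraph n m) →
    Compressed G → TemporallyConnected G → Minimal G →
    count (divergentEdge? G) ≤ count (labelledOne? G)
lemma3p33 G compressed _ minimal =
  count-≤ (divergentEdge? G) (labelledOne? G)
    -- Here `R` is `Leads G`, from the edge labelled 1 to the divergent edge.
    (λ e _ → ledToByOne G compressed e)
    (divergent-Leads-unique G minimal)
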